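{- Let $G$ be a quadrangulation of an orientable surface. Then $G$ admits no proper vertex-$4$-coloring such that the number of rainbow-faces of $G$ is odd.
   Context: All graphs are loopless and finite. A cycle is a connected $2$-regular graph. An orientable surface here means a sphere with $k\ge 0$ attached handles. A quadrangulation of such a surface is a $2$-edge-connected graph embedded on the surface such that every face boundary is a cycle of length four. A vertex-coloring is proper if any two adjacent vertices receive different colors; a proper vertex-$4$-coloring of $G$ is a proper vertex-coloring $g: V(G)\to\{1,2,3,4\}$. Given such a coloring, a face of $G$ is a rainbow-face if all four distinct colors appear on its boundary. -}

module Defs where

open import Data.Bool.Base using (Bool; true; false; not)
open import Data.Fin.Base using (Fin)
open import Data.Fin.Properties using (_≟_; any?; all?)
open import Data.Nat.Base using (ℕ; _+_; _*_)
open import Data.Nat.GeneralisedArithmetic using (iterate)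
open import Data.Product.Base using (_×_; _,_; ∃; ∃-syntax; proj₁; proj₂)
open import Data.Sum.Base using (_⊎_; inj₁; inj₂; [_,_]′)
open import Data.Unit.Base using (⊤)
open import Data.Vec.Base using (allFin; count)
open import Function.Base using (_∘_)
open import Function.Bundles using (_↔_; _⇔_; mk⇔; module Inverse; module Equivalence)
open import Level using (0ℓ)
open import Relation.Binary.Construct.Closure.ReflexiveTransitive using (Star)
open import Relation.Binary.PropositionalEquality
  using (_≡_; _≢_; refl; sym; trans)
open import Relation.Nullary.Decidable using (Dec; yes; map; ¬?; _×-dec_; _⊎-dec_)
open import Relation.Unary using (Pred; Decidable)

-- The order of the two ends of an edge carries no meaning.  Parallel edges
-- are allowed.
record Graph : Set where
  field
    #V #E    : ℕ
    ends     : Fin #E → Fin #V × Fin #V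
    loopless : ∀ e → proj₁ (ends e) ≢ proj₂ (ends e)

  Vertex Edge : Set
  Vertex = Fin #V
  Edge   = Fin #E

  -- An edge together with a direction of traversal.
  Dart : Set
  Dart = Edge × Bool

  edge : Dart → Edge
  edge = proj₁

  rev : Dart → Dart
  rev (e , s) = e , not s

  tail head : Dart → Vertex
  tail (e , false) = proj₁ (ends e)
  tail (e , true)  = proj₂ (ends e)
  head = tail ∘ rev

  Incident : Vertex → Edge → Set
  Incident v e = tail (e , false) ≡ v ⊎ tail (e , true) ≡ v

  incident? : ∀ v → Decidable (Incident v)
  incident? v e = (tail (e , false) ≟ v) ⊎-dec (tail (e , true) ≟ v)

open Graph public using (Vertex; Edge; Dart)

anyDart? : ∀ (G : Graph) {P : Pred (Dart G) 0ℓ} → Decidable P → Dec (∃ P)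
anyDart? G {P} P? = map (mk⇔ to from)
  (any? (λ e → P? (e , false) ⊎-dec P? (e , true)))
  where
  to : (∃[ e ] (P (e , false) ⊎ P (e , true))) → ∃ P
  to (e , p) = [ (λ q → (e , false) , q) , (λ q → (e , true) , q) ]′ p

  from : ∃ P → ∃[ e ] (P (e , false) ⊎ P (e , true))
  from ((e , false) , p) = e , inj₁ p
  from ((e , true)  , p) = e , inj₂ p

record Subgraph (G : Graph) : Set₁ where
  open Graph G using (#E; tail; head; edge; Incident; incident?)
  field
    _∈V    : Pred (Vertex G) 0ℓ
    _∈E    : Pred (Edge G) 0ℓ
    _∈E?   : Decidable _∈E
    closed : ∀ d → edge d ∈E → tail d ∈V

  size : ℕ
  size = count _∈E? (allFin #E)

  -- Since there are no loops, no edge has to be counted twice.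
  degree : Vertex G → ℕ
  degree v = count (λ e → (e ∈E?) ×-dec incident? v e) (allFin #E)

  Step : Vertex G → Vertex G → Set
  Step u v = ∃[ d ] (edge d ∈E × tail d ≡ u × head d ≡ v)

  Connected : Set
  Connected = ∃ _∈V × (∀ {u v} → u ∈V → v ∈V → Star Step u v)

  Regular : ℕ → Set
  Regular r = ∀ {v} → v ∈V → degree v ≡ r

  IsCycle : Set
  IsCycle = Connected × Regular 2

module _ (G : Graph) where
  whole : Subgraph G
  whole = record
    { _∈V = λ _ → ⊤ ; _∈E = λ _ → ⊤ ; _∈E? = λ _ → yes _ ; closed = λ _ _ → _ }

  delete : Edge G → Subgraph G
  delete e = record
    { _∈V = λ _ → ⊤ ; _∈E = _≢ e ; _∈E? = λ e′ → ¬? (e′ ≟ e) ; closed = λ _ _ → _ }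

  TwoEdgeConnected : Set
  TwoEdgeConnected =
    Subgraph.Connected whole × (∀ e → Subgraph.Connected (delete e))

SameOrbit : ∀ {A : Set} → (A → A) → A → A → Set
SameOrbit f x y = ∃[ n ] iterate f x n ≡ y

-- A cellular embedding of G on the sphere with k handles, given as a rotation
-- system (Heffter–Edmonds).  `rotation` sends a dart to the next dart in the
-- cyclic order around its tail, following the orientation of the surface.
-- Arriving at a vertex along d, the boundary walk of a face goes on with the
-- successor of rev d, so the faces are the orbits of `next`; `face d` is the
-- face whose boundary walk runs along d.  The genus is pinned down by Euler's
-- formula #V − #E + #F = 2 − 2k (for connected G).
record Embedding (G : Graph) (k : ℕ) : Set where
  open Graph G using (#V; #E; tail; head; edge; rev)
  field
    rotation        : Dart G ↔ Dart G
    rotation-orbits : ∀ d d′ →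
      tail d ≡ tail d′ ⇔ SameOrbit (Inverse.to rotation) d d′

  next : Dart G → Dart G
  next d = Inverse.to rotation (rev d)

  field
    #F          : ℕ
    face        : Dart G → Fin #F
    face-onto   : ∀ f → ∃[ d ] face d ≡ f
    face-orbits : ∀ d d′ → face d ≡ face d′ ⇔ SameOrbit next d d′
    euler       : #V + #F + 2 * k ≡ #E + 2

  Face : Set
  Face = Fin #F

  tail-next : ∀ d → tail (next d) ≡ head d
  tail-next d = sym (Equivalence.from (rotation-orbits (rev d) (next d)) (1 , refl))

  face-next : ∀ d → face (next d) ≡ face d
  face-next d = sym (Equivalence.from (face-orbits d (next d)) (1 , refl))

  boundary : Face → Subgraph G
  boundary f = record
    { _∈V    = λ v → ∃[ d ] (face d ≡ f × tail d ≡ v)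
    ; _∈E    = λ e → ∃[ d ] (face d ≡ f × edge d ≡ e)
    ; _∈E?   = λ e → anyDart? G (λ d → (face d ≟ f) ×-dec (edge d ≟ e))
    ; closed = closed
    }
    where
    closed : ∀ d → ∃[ d′ ] (face d′ ≡ f × edge d′ ≡ edge d) →
             ∃[ d′ ] (face d′ ≡ f × tail d′ ≡ tail d)
    closed (e , false) ((.e , false) , p , refl) = _ , p , refl
    closed (e , true)  ((.e , true)  , p , refl) = _ , p , refl
    closed (e , false) ((.e , true)  , p , refl) =
      _ , trans (face-next _) p , tail-next _
    closed (e , true)  ((.e , false) , p , refl) =
      _ , trans (face-next _) p , tail-next _

record Quadrangulation (G : Graph) (k : ℕ) : Set where
  field
    twoEdgeConnected : TwoEdgeConnected G
    embedding        : Embedding G k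
  open Embedding embedding public
  field
    faces-4-cycles : ∀ f → Subgraph.IsCycle (boundary f)
                           × Subgraph.size (boundary f) ≡ 4

IsProper : ∀ (G : Graph) {q} → (Vertex G → Fin q) → Set
IsProper G g = ∀ d → g (Graph.tail G d) ≢ g (Graph.head G d)

module _ {G : Graph} {k : ℕ} (M : Embedding G k) (g : Vertex G → Fin 4) where
  open Graph G using (tail)
  open Embedding M

  IsRainbow : Face → Set
  IsRainbow f = ∀ c → ∃[ v ] (Subgraph._∈V (boundary f) v × g v ≡ c)

  isRainbow? : Decidable IsRainbow
  isRainbow? f = all? λ c → any? λ v →
    anyDart? G (λ d → (face d ≟ f) ×-dec (tail d ≟ v)) ×-dec (g v ≟ c)

  #rainbow : ℕ
  #rainbow = count isRainbow? (allFin #F)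

{-# OPTIONS --safe #-}

-- Fix the tournament 0→1→2→3, 0→3, 1→3, 2→0 on the four colours.  It has an
-- odd number of arcs along each of the six directed Hamiltonian cycles of K₄,
-- whereas a closed walk of length four in K₄ that misses a colour retraces
-- its steps and follows exactly two arcs.  Orient every edge of G by the
-- colours of its ends and count the darts d that follow the orientation.
-- Each edge has exactly one of them, so there are #E.  The boundary walk of a
-- face never passes an edge in both directions, hence consists of four darts;
-- an odd number of them follow the orientation precisely if the face is
-- rainbow, so #rainbow ≡ #E modulo 2.  Finally 2 #E = 4 #F, as both sides
-- count all darts, so #E = 2 #F is even.
module Submission where

open import Defs
open import Algebra.Bundles using (CommutativeMonoid)
import Algebra.Properties.CommutativeMonoid.Sum as Sum
open import Data.Bool.Base using (Bool; true; false; if_then_else_)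
open import Data.Bool.Properties using (not-involutive)
open import Data.Fin.Base using (Fin; zero; suc; toℕ; _↑ˡ_; _↑ʳ_; combine; remQuot)
open import Data.Fin.Patterns using (0F; 1F; 2F; 3F)
open import Data.Fin.Permutation using (Permutation; ↔⇒≡)
open import Data.Fin.Properties
  using (_≟_; all?; *↔×; 2↔Bool; remQuot-combine; splitAt-↑ʳ; pigeonhole; injective⇒≤; toℕ-fromℕ<;
         toℕ≤pred[n]; toℕ<n; toℕ-injective; suc-injective)
import Data.List.Base as List
open import Data.List.Membership.DecPropositional {A = Fin 4} _≟_ using (_∈_; _∈?_)
open import Data.List.Membership.Propositional.Properties using (∈-tabulate⁺; ∈-tabulate⁻)
open import Data.Nat.Base as ℕ using (ℕ; zero; suc; parity; _≤_; _<_; z<s; s<s; _∸_; NonZero)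
import Data.Nat.DivMod as ℕ
import Data.Nat.Properties as ℕ
open import Data.Nat.GeneralisedArithmetic using (iterate)
open import Data.Parity.Base as ℙ using (Parity; 0ℙ; 1ℙ)
import Data.Parity.Properties as ℙ
open import Data.Product.Base using (Σ; _×_; _,_; ∃-syntax; proj₁; proj₂; map₁)
open import Data.Product.Function.NonDependent.Propositional using (_×-↔_)
open import Data.Sum.Base using (_⊎_; inj₁; inj₂)
open import Data.Vec.Base using (tabulate; allFin; count)
open import Function.Base using (_∘_; id)
open import Function.Bundles using (_↔_; _⇔_; mk⇔; mk⤖; module Inverse; module Injection; module Equivalence)
open import Function.Construct.Composition using (_↔-∘_)
open import Function.Construct.Identity using (↔-id)
open import Function.Construct.Symmetry using (↔-sym)
open import Function.Definitions using (Injective)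
open import Function.Properties.Bijection using (⤖⇒↔)
open import Function.Properties.Inverse using (↔⇒↣)
open import Level using (Level)
open import Relation.Binary.Definitions using (Tri; tri<; tri≈; tri>)
open import Relation.Binary.PropositionalEquality
  using (_≡_; _≢_; refl; sym; trans; cong; cong₂; subst; module ≡-Reasoning)
open import Relation.Nullary using (¬_; Dec; yes; no; does; contradiction)
open import Relation.Nullary.Decidable using (from-yes; does-⇔; ¬?; _→-dec_)
open import Relation.Unary using (Pred; Decidable)

private variable
  a p : Level
  A   : Set a
  m n : ℕ

-- Sums over finite types

remQuot-↑ʳ : ∀ m (x : Fin (m ℕ.* n)) → remQuot {suc m} n (n ↑ʳ x) ≡ map₁ suc (remQuot {m} n x)
remQuot-↑ʳ {n} m x rewrite splitAt-↑ʳ n (m ℕ.* n) x = refl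

module _ {c ℓ} (M : CommutativeMonoid c ℓ) where
  open CommutativeMonoid M using (Carrier; _≈_; _∙_; setoid; assoc; identityˡ; ∙-congˡ)
    renaming (refl to ≈-refl; sym to ≈-sym; trans to ≈-trans)
  open Sum M using (sum; sum-syntax; sum-permute; sum-cong-≗)
  open import Relation.Binary.Reasoning.Setoid setoid

  sum-splitAt : ∀ m {n} (t : Fin (m ℕ.+ n) → Carrier) →
                sum t ≈ sum (t ∘ (_↑ˡ n)) ∙ sum (t ∘ (m ↑ʳ_))
  sum-splitAt zero    t = ≈-sym (identityˡ _)
  sum-splitAt (suc m) t = ≈-trans (∙-congˡ (sum-splitAt m (t ∘ suc))) (≈-sym (assoc _ _ _))

  sum-remQuot : ∀ m {n} (t : Fin m × Fin n → Carrier) →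
                sum (t ∘ remQuot {m} n) ≈ ∑[ i < m ] ∑[ j < n ] t (i , j)
  sum-remQuot zero        t = ≈-refl
  sum-remQuot (suc m) {n} t = begin
    sum (t ∘ remQuot {suc m} n)
      ≈⟨ sum-splitAt n _ ⟩
    sum (t ∘ remQuot {suc m} n ∘ combine {suc m} 0F)
      ∙ sum (t ∘ remQuot {suc m} n ∘ (n ↑ʳ_))
      ≡⟨ cong₂ _∙_ (sum-cong-≗ λ j → cong t (remQuot-combine {suc m} 0F j))
                   (sum-cong-≗ λ x → cong t (remQuot-↑ʳ m x)) ⟩
    (∑[ j < n ] t (0F , j)) ∙ sum (t ∘ map₁ suc ∘ remQuot {m} n)
      ≈⟨ ∙-congˡ (sum-remQuot m _) ⟩
    (∑[ j < n ] t (0F , j)) ∙ (∑[ i < m ] ∑[ j < n ] t (suc i , j)) ∎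

  -- Both double sums flatten to single sums over `Fin (n ℕ.* b)` and `Fin (m ℕ.* a)`, and between
  -- these `π` becomes the permutation `ρ`. This is the exchange of summation behind the double
  -- count of darts.
  sum-reindex : ∀ {m n a b} (π : (Fin m × Fin a) ↔ (Fin n × Fin b)) (t : Fin n × Fin b → Carrier) →
                ∑[ k < n ] ∑[ l < b ] t (k , l) ≈ ∑[ i < m ] ∑[ j < a ] t (Inverse.to π (i , j))
  sum-reindex {m} {n} {a} {b} π t = begin
    ∑[ k < n ] ∑[ l < b ] t (k , l)
      ≈⟨ sum-remQuot n t ⟨
    sum (t ∘ remQuot {n} b)
      ≈⟨ sum-permute _ ρ ⟩
    sum (t ∘ remQuot {n} b ∘ Inverse.to ρ)
      ≡⟨ sum-cong-≗ {m ℕ.* a} (λ x → cong t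
           (Inverse.strictlyInverseˡ (*↔× {n} {b}) (Inverse.to π (remQuot {m} a x)))) ⟩
    sum (t ∘ Inverse.to π ∘ remQuot {m} a)
      ≈⟨ sum-remQuot m (t ∘ Inverse.to π) ⟩
    ∑[ i < m ] ∑[ j < a ] t (Inverse.to π (i , j)) ∎
    where
    ρ : Permutation (m ℕ.* a) (n ℕ.* b)
    ρ = ↔-sym *↔× ↔-∘ (π ↔-∘ *↔×)

open Sum ℙ.+-0-commutativeMonoid using (sum; sum-syntax; sum-cong-≗)

sum-1ℙ : ∀ n → (∑[ i < n ] 1ℙ) ≡ parity n
sum-1ℙ zero    = refl
sum-1ℙ (suc n) = trans (cong (1ℙ ℙ.+_) (sum-1ℙ n)) (sym (ℙ.+-homo-+ 1 n))

-- Counting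

indicator : Bool → Parity
indicator b = if b then 1ℙ else 0ℙ

module _ {P : Pred A p} (P? : Decidable P) where

  parity-count : ∀ (e : Fin n → A) →
                 parity (count P? (tabulate e)) ≡ ∑[ i < n ] indicator (does (P? (e i)))
  parity-count {n = zero}  e = refl
  parity-count {n = suc n} e with does (P? (e 0F))
  ... | true  = trans (ℙ.+-homo-+ 1 (count P? (tabulate (e ∘ suc))))
                      (cong (1ℙ ℙ.+_) (parity-count (e ∘ suc)))
  ... | false = parity-count (e ∘ suc)

  -- The rank of `i` among the indices counted; `count-lookup` goes from ranks back to indices. The
  -- injectivity of each turns counts into cardinalities.
  count-index : ∀ (e : Fin n → A) i → P (e i) → Fin (count P? (tabulate e))
  count-index e zero    p with P? (e 0F)
  ... | yes _ = zero
  ... | no ¬p = contradiction p ¬p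
  count-index e (suc i) p with does (P? (e 0F))
  ... | true  = suc (count-index (e ∘ suc) i p)
  ... | false = count-index (e ∘ suc) i p

  count-index-injective : ∀ (e : Fin n → A) {i j} (p : P (e i)) (q : P (e j)) →
                          count-index e i p ≡ count-index e j q → i ≡ j
  count-index-injective e {zero}  {zero}  p q eq = refl
  count-index-injective e {zero}  {suc j} p q eq with P? (e 0F)
  ... | no ¬p = contradiction p ¬p
  count-index-injective e {suc i} {zero}  p q eq with P? (e 0F)
  ... | no ¬p = contradiction q ¬p
  count-index-injective e {suc i} {suc j} p q eq with does (P? (e 0F))
  ... | true  = cong suc (count-index-injective (e ∘ suc) p q (suc-injective eq))
  ... | false = cong suc (count-index-injective (e ∘ suc) p q eq)

  count-lookup : ∀ (e : Fin n → A) → Fin (count P? (tabulate e)) → ∃[ i ] P (e i)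
  count-lookup {n = suc n} e k with P? (e 0F)
  count-lookup {n = suc n} e zero    | yes p = 0F , p
  count-lookup {n = suc n} e (suc k) | yes p = let i , q = count-lookup (e ∘ suc) k in suc i , q
  count-lookup {n = suc n} e k       | no _  = let i , q = count-lookup (e ∘ suc) k in suc i , q

  count-lookup-injective : ∀ (e : Fin n → A) {k l} →
                           proj₁ (count-lookup e k) ≡ proj₁ (count-lookup e l) → k ≡ l
  count-lookup-injective {n = suc n} e {k}     {l}     eq with P? (e 0F)
  count-lookup-injective {n = suc n} e {zero}  {zero}  eq | yes p = refl
  count-lookup-injective {n = suc n} e {suc k} {suc l} eq | yes p =
    cong suc (count-lookup-injective (e ∘ suc) (suc-injective eq))
  count-lookup-injective {n = suc n} e {k}     {l}     eq | no _  =
    count-lookup-injective (e ∘ suc) (suc-injective eq)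

module _ {P : Pred (Fin n) p} (P? : Decidable P) where

  injective⇒≤count : ∀ {f : Fin m → Fin n} → Injective _≡_ _≡_ f → (∀ i → P (f i)) →
                     m ≤ count P? (allFin n)
  injective⇒≤count inj p =
    injective⇒≤ {f = λ i → count-index P? id _ (p i)}
                (λ {i} {j} eq → inj (count-index-injective P? id (p i) (p j) eq))

  -- Choose a preimage under `f` for every counted element; `f` recovers the element, so distinct
  -- elements get distinct preimages.
  covering⇒count≤ : ∀ (f : Fin m → Fin n) → (∀ {x} → P x → ∃[ i ] f i ≡ x) →
                    count P? (allFin n) ≤ m
  covering⇒count≤ f cover =
    injective⇒≤ {f = λ k → proj₁ (c k)} λ {k} {l} eq →
      count-lookup-injective P? id
        (trans (sym (proj₂ (c k))) (trans (cong f eq) (proj₂ (c l))))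
    where
    c : ∀ k → ∃[ i ] f i ≡ proj₁ (count-lookup P? id k)
    c k = cover (proj₂ (count-lookup P? id k))

-- Iteration

module _ {A : Set} (f : A → A) where

  iterate-+ : ∀ x m n → iterate f x (m ℕ.+ n) ≡ iterate f (iterate f x m) n
  iterate-+ x zero    n = refl
  iterate-+ x (suc m) n = iterate-+ (f x) m n

  -- `iterate` unfolds at the first step of a walk; this splits off the last one instead.
  iterate-suc : ∀ x n → iterate f (f x) n ≡ f (iterate f x n)
  iterate-suc x zero    = refl
  iterate-suc x (suc n) = iterate-suc (f x) n

  iterate-injective : Injective _≡_ _≡_ f → ∀ n → Injective _≡_ _≡_ (λ x → iterate f x n)
  iterate-injective inj zero    eq = eq
  iterate-injective inj (suc n) eq = inj (iterate-injective inj n eq)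

  iterate-cancel : Injective _≡_ _≡_ f → ∀ {x m n} → m ≤ n →
                   iterate f x m ≡ iterate f x n → iterate f x (n ∸ m) ≡ x
  iterate-cancel inj {x} {m} {n} m≤n eq = iterate-injective inj m (begin
    iterate f (iterate f x (n ∸ m)) m ≡⟨ iterate-+ x (n ∸ m) m ⟨
    iterate f x (n ∸ m ℕ.+ m)         ≡⟨ cong (iterate f x) (ℕ.m∸n+n≡m m≤n) ⟩
    iterate f x n                     ≡⟨ eq ⟨
    iterate f x m                     ∎)
    where open ≡-Reasoning

  module _ {x : A} {n : ℕ} (fⁿx≡x : iterate f x n ≡ x) where

    iterate-* : ∀ k → iterate f x (k ℕ.* n) ≡ x
    iterate-* zero    = refl
    iterate-* (suc k) = trans (iterate-+ x n (k ℕ.* n))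
      (trans (cong (λ y → iterate f y (k ℕ.* n)) fⁿx≡x) (iterate-* k))

    -- The number of steps can be reduced modulo the period `n`.
    periodic-orbit : .{{_ : NonZero n}} → ∀ {y} → SameOrbit f x y →
                     ∃[ i ] iterate f x (toℕ {n} i) ≡ y
    periodic-orbit {y} (m , eq) = m ℕ.mod n , (begin
      iterate f x (toℕ (m ℕ.mod n))                       ≡⟨ cong (iterate f x) (toℕ-fromℕ< (ℕ.m%n<n m n)) ⟩
      iterate f x (m ℕ.% n)                               ≡⟨ cong (λ z → iterate f z (m ℕ.% n)) (iterate-* (m ℕ./ n)) ⟨
      iterate f (iterate f x (m ℕ./ n ℕ.* n)) (m ℕ.% n)   ≡⟨ iterate-+ x (m ℕ./ n ℕ.* n) (m ℕ.% n) ⟨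
      iterate f x (m ℕ./ n ℕ.* n ℕ.+ m ℕ.% n)             ≡⟨ cong (iterate f x) (ℕ.+-comm (m ℕ./ n ℕ.* n) (m ℕ.% n)) ⟩
      iterate f x (m ℕ.% n ℕ.+ m ℕ./ n ℕ.* n)             ≡⟨ cong (iterate f x) (ℕ.m≡m%n+[m/n]*n m n) ⟨
      iterate f x m                                       ≡⟨ eq ⟩
      y                                                   ∎)
      where open ≡-Reasoning

-- Boundary walks of faces

module _ (G : Graph) where
  open Graph G using (#E; tail; head; edge; rev; Incident; loopless)

  loopless-dart : ∀ d → tail d ≢ head d
  loopless-dart (e , false) = loopless e
  loopless-dart (e , true)  = loopless e ∘ sym

  rev-involutive : ∀ d → rev (rev d) ≡ d
  rev-involutive (e , s) = cong (e ,_) (not-involutive s)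

  rev-injective : Injective _≡_ _≡_ rev
  rev-injective {d} {d′} eq =
    trans (sym (rev-involutive d)) (trans (cong rev eq) (rev-involutive d′))

  edge-≡ : ∀ {d d′} → edge d ≡ edge d′ → d ≡ d′ ⊎ d ≡ rev d′
  edge-≡ {e , false} {.e , false} refl = inj₁ refl
  edge-≡ {e , false} {.e , true}  refl = inj₂ refl
  edge-≡ {e , true}  {.e , false} refl = inj₂ refl
  edge-≡ {e , true}  {.e , true}  refl = inj₁ refl

  tail⇒Incident : ∀ {v} d → tail d ≡ v → Incident v (edge d)
  tail⇒Incident (e , false) = inj₁
  tail⇒Incident (e , true)  = inj₂

  Incident⇒tail : ∀ {v e} → Incident v e → ∃[ d ] (edge d ≡ e × tail d ≡ v)
  Incident⇒tail {e = e} (inj₁ eq) = (e , false) , refl , eq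
  Incident⇒tail {e = e} (inj₂ eq) = (e , true)  , refl , eq

module _ {G : Graph} {k : ℕ} (M : Embedding G k) where
  open Graph G using (#E; tail; head; edge; rev; Incident; loopless)
  open Embedding M

  next-injective : Injective _≡_ _≡_ next
  next-injective = rev-injective G ∘ Injection.injective (↔⇒↣ rotation)

  face-iterate : ∀ d n → face (iterate next d n) ≡ face d
  face-iterate d n = sym (Equivalence.from (face-orbits d _) (n , refl))

  module _ (regular : ∀ f → Subgraph.Regular (boundary f) 2) where

    private
      degree-head : ∀ d → Subgraph.degree (boundary (face d)) (head d) ≡ 2
      degree-head d = regular (face d) (next d , face-next d , tail-next d)

    -- Otherwise d would end at a vertex of degree one.
    next≢rev : ∀ d → next d ≢ rev d
    next≢rev d eq = ℕ.<⇒≱ (s<s z<s) (begin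
      2                                             ≡⟨ degree-head d ⟨
      Subgraph.degree (boundary (face d)) (head d)  ≤⟨ covering⇒count≤ _ {m = 1} (λ _ → edge d) (λ q → 0F , only-edge (proj₂ q)) ⟩
      1                                             ∎)
      where
      open ℕ.≤-Reasoning

      only-edge : ∀ {e} → Incident (head d) e → edge d ≡ e
      only-edge i with d′ , refl , td′ ← Incident⇒tail G i =
        -- `eq` says that the rotation fixes `rev d`. Its orbit, which contains all darts leaving
        -- `head d`, is therefore `rev d` alone.
        let m , m≡ = periodic-orbit (Inverse.to rotation) {n = 1} eq
                       (Equivalence.to (rotation-orbits (rev d) d′) (sym td′))
        in cong edge (fixed m m≡)
        where
        fixed : ∀ (m : Fin 1) {y} → iterate (Inverse.to rotation) (rev d) (toℕ m) ≡ y → rev d ≡ y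
        fixed 0F eq = eq

    edge-next≢ : ∀ d → edge (next d) ≢ edge d
    edge-next≢ d eq with edge-≡ G {next d} {d} eq
    ... | inj₁ next≡    = loopless-dart G d (trans (cong tail (sym next≡)) (tail-next d))
    ... | inj₂ next≡rev = next≢rev d next≡rev

    -- Since `next x ≡ rev d`, the dart `x` ends at `head d`. So `edge d`, `edge (next d)` and
    -- `edge x` are boundary edges at a vertex of degree two and cannot all differ; the first
    -- differs from the other two because consecutive edges of the walk are distinct.
    next-pred-edge : ∀ d x → face x ≡ face d → next x ≡ rev d → edge x ≡ edge (next d)
    next-pred-edge d x fx eq with edge x ≟ edge (next d)
    ... | yes x≡ = x≡
    ... | no x≢ = contradiction
      (ℕ.≤-trans (injective⇒≤count _ {f = es} es-injective es-member) (ℕ.≤-reflexive (degree-head d)))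
      (ℕ.<⇒≱ (s<s (s<s z<s)))
      where
      x≢d : edge x ≢ edge d
      x≢d x≡d = edge-next≢ x (trans (cong edge eq) (sym x≡d))

      es : Fin 3 → Edge G
      es 0F = edge d
      es 1F = edge (next d)
      es 2F = edge x

      es-injective : Injective _≡_ _≡_ es
      es-injective {0F} {0F} _  = refl
      es-injective {0F} {1F} eq = contradiction (sym eq) (edge-next≢ d)
      es-injective {0F} {2F} eq = contradiction (sym eq) x≢d
      es-injective {1F} {0F} eq = contradiction eq (edge-next≢ d)
      es-injective {1F} {1F} _  = refl
      es-injective {1F} {2F} eq = contradiction (sym eq) x≢
      es-injective {2F} {0F} eq = contradiction eq x≢d
      es-injective {2F} {1F} eq = contradiction eq x≢
      es-injective {2F} {2F} _  = refl

      es-member : ∀ i → Subgraph._∈E (boundary (face d)) (es i) × Incident (head d) (es i)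
      es-member 0F = (d , refl , refl) , tail⇒Incident G (rev d) refl
      es-member 1F = (next d , face-next d , refl) , tail⇒Incident G (next d) (tail-next d)
      es-member 2F = (x , fx , refl) ,
        tail⇒Incident G (rev x) (trans (sym (tail-next x)) (cong tail eq))

    -- If the walk from d arrives at rev d, then its last step before that is
    -- the reverse of next d: the walk from next d is a shorter counterexample.
    iterate-next≢rev : ∀ n d → iterate next d n ≢ rev d
    iterate-next≢rev zero          d eq = loopless-dart G d (cong tail eq)
    iterate-next≢rev (suc zero)    d eq = next≢rev d eq
    iterate-next≢rev (suc (suc n)) d eq
      with edge-≡ G (next-pred-edge d x (trans (face-iterate (next d) n) (face-next d)) next-x)
      where
      x = iterate next (next d) n
      next-x : next x ≡ rev d
      next-x = trans (sym (iterate-suc next (next d) n)) eq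
    ... | inj₂ x≡rev  = iterate-next≢rev n (next d) x≡rev
    -- Here `next d` is directly followed by `rev d`, so it both starts and ends at `head d`.
    ... | inj₁ x≡next = loopless-dart G (next d) (begin
      tail (next d)                         ≡⟨ tail-next d ⟩
      tail (rev d)                          ≡⟨ cong tail eq ⟨
      tail (iterate next (next (next d)) n) ≡⟨ cong tail (iterate-suc next (next d) n) ⟩
      tail (next (iterate next (next d) n)) ≡⟨ cong (tail ∘ next) x≡next ⟩
      tail (next (next d))                  ≡⟨ tail-next (next d) ⟩
      head (next d)                         ∎)
      where open ≡-Reasoning

    -- Otherwise `d` is `rev d′`, and the boundary walk of the common face leads from `d′` to its
    -- reverse.
    edge-injective-on-face : ∀ {d d′} → face d ≡ face d′ → edge d ≡ edge d′ → d ≡ d′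
    edge-injective-on-face {d} {d′} fd≡ eq with edge-≡ G {d} {d′} eq
    ... | inj₁ d≡ = d≡
    ... | inj₂ d≡ =
      let n , n≡ = Equivalence.to (face-orbits d′ d) (sym fd≡)
      in contradiction (trans n≡ d≡) (iterate-next≢rev n d′)

    size≤period : ∀ d n .{{_ : NonZero n}} → iterate next d n ≡ d →
                  Subgraph.size (boundary (face d)) ≤ n
    size≤period d n eq = covering⇒count≤ _ (λ i → edge (iterate next d (toℕ i)))
      λ { (d′ , fd′ , refl) →
          let i , i≡ = periodic-orbit next eq (Equivalence.to (face-orbits d d′) (sym fd′))
          in i , cong edge i≡ }

    -- A repetition would give the walk the period `n ∸ m`, which is positive but smaller than the
    -- number of boundary edges.
    iterate-distinct : ∀ d {m n} → m < n → n < Subgraph.size (boundary (face d)) →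
                       iterate next d m ≢ iterate next d n
    iterate-distinct d {m} {n} m<n n<size eq = ℕ.<⇒≱ n<size
      (ℕ.≤-trans (size≤period d (n ∸ m) (iterate-cancel next next-injective (ℕ.<⇒≤ m<n) eq))
                 (ℕ.m∸n≤m n m))
      where instance _ = ℕ.>-nonZero (ℕ.m<n⇒0<n∸m m<n)

    -- Among the first `size + 1` darts of the walk, two share an edge by pigeonhole and hence
    -- coincide. The resulting period is at most `size`, and by `size≤period` it is no smaller.
    iterate-size : ∀ d → iterate next d (Subgraph.size (boundary (face d))) ≡ d
    iterate-size d =
      let i , j , i<j , eq = pigeonhole (ℕ.n<1+n _) index
          instance _ = ℕ.>-nonZero (ℕ.m<n⇒0<n∸m i<j)
          period = iterate-cancel next next-injective (ℕ.<⇒≤ i<j) (index-injective i j eq)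
      in subst (λ n → iterate next d n ≡ d)
           (ℕ.≤-antisym (ℕ.≤-trans (ℕ.m∸n≤m (toℕ j) (toℕ i)) (toℕ≤pred[n] j))
                        (size≤period d _ period))
           period
      where
      open Subgraph (boundary (face d)) using (size; _∈E; _∈E?)

      member : ∀ n → edge (iterate next d n) ∈E
      member n = iterate next d n , face-iterate d n , refl

      index : Fin (suc size) → Fin size
      index i = count-index _∈E? id _ (member (toℕ i))

      index-injective : ∀ i j → index i ≡ index j →
                        iterate next d (toℕ i) ≡ iterate next d (toℕ j)
      index-injective i j eq = edge-injective-on-face
        (trans (face-iterate d (toℕ i)) (sym (face-iterate d (toℕ j))))
        (count-index-injective _∈E? id (member (toℕ i)) (member (toℕ j)) eq)

-- The tournament on the colours

-- The last clause covers the reversed arcs and also the diagonal, which the disequalities in the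
-- lemmas below exclude.
arc : Fin 4 → Fin 4 → Parity
arc 0F 1F = 1ℙ
arc 1F 2F = 1ℙ
arc 2F 3F = 1ℙ
arc 0F 3F = 1ℙ
arc 1F 3F = 1ℙ
arc 2F 0F = 1ℙ
arc _  _  = 0ℙ

arc-tournament : ∀ x y → x ≢ y → arc x y ℙ.+ (arc y x ℙ.+ 0ℙ) ≡ 1ℙ
arc-tournament = from-yes (all? λ x → all? λ y →
  ¬? (x ≟ y) →-dec (arc x y ℙ.+ (arc y x ℙ.+ 0ℙ) ℙ.≟ 1ℙ))

allColours? : (xs : List.List (Fin 4)) → Dec (∀ c → c ∈ xs)
allColours? xs = all? (_∈? xs)

-- Bracketed, with a final `0ℙ`, exactly as a sum over `Fin 4` unfolds.
arcs : (x y z w : Fin 4) → Parity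
arcs x y z w = arc x y ℙ.+ (arc y z ℙ.+ (arc z w ℙ.+ (arc w x ℙ.+ 0ℙ)))

quadruple : (x y z w : Fin 4) → List.List (Fin 4)
quadruple x y z w = x List.∷ y List.∷ z List.∷ w List.∷ List.[]

-- Decided by evaluating all 256 quadruples. When a colour is missing, `x ≡ z` or `y ≡ w`, so the
-- four steps form two back-and-forth pairs with one arc each.
arcs-parity : ∀ x y z w → x ≢ y → y ≢ z → z ≢ w → w ≢ x →
  arcs x y z w ≡ indicator (does (allColours? (quadruple x y z w)))
arcs-parity = from-yes (all? λ x → all? λ y → all? λ z → all? λ w →
  ¬? (x ≟ y) →-dec ¬? (y ≟ z) →-dec ¬? (z ≟ w) →-dec ¬? (w ≟ x) →-dec
  (arcs x y z w ℙ.≟ indicator (does (allColours? (quadruple x y z w)))))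

-- Darts of a quadrangulation, counted by faces and by edges

module _ {G : Graph} {k : ℕ} (Q : Quadrangulation G k) where
  open Graph G using (#E; tail; head; edge; rev; Incident; loopless)
  open Quadrangulation Q

  private
    regular : ∀ f → Subgraph.Regular (boundary f) 2
    regular f = proj₂ (proj₁ (faces-4-cycles f))

    size≡4 : ∀ f → Subgraph.size (boundary f) ≡ 4
    size≡4 f = proj₂ (faces-4-cycles f)

  iterate-4 : ∀ d → iterate next d 4 ≡ d
  iterate-4 d = subst (λ n → iterate next d n ≡ d) (size≡4 (face d))
                      (iterate-size embedding regular d)

  -- The boundary walk of `f`, started at the dart that `face-onto` supplies.
  corner : Face × Fin 4 → Dart G
  corner (f , i) = iterate next (proj₁ (face-onto f)) (toℕ i)

  face-corner : ∀ f i → face (corner (f , i)) ≡ f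
  face-corner f i = trans (face-iterate embedding _ (toℕ i)) (proj₂ (face-onto f))

  corner-covers : ∀ {f d} → face d ≡ f → ∃[ i ] corner (f , i) ≡ d
  corner-covers {f} {d} fd = periodic-orbit next (iterate-4 r)
    (Equivalence.to (face-orbits r d) (trans (proj₂ (face-onto f)) (sym fd)))
    where r = proj₁ (face-onto f)

  iterate-distinct-4 : ∀ d {i j : Fin 4} → toℕ i < toℕ j →
                       iterate next d (toℕ i) ≢ iterate next d (toℕ j)
  iterate-distinct-4 d {j = j} i<j = iterate-distinct embedding regular d i<j
    (ℕ.<-≤-trans (toℕ<n j) (ℕ.≤-reflexive (sym (size≡4 (face d)))))

  iterate-injective-4 : ∀ d {i j : Fin 4} →
                        iterate next d (toℕ i) ≡ iterate next d (toℕ j) → i ≡ j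
  iterate-injective-4 d {i} {j} eq = by-cmp (ℕ.<-cmp (toℕ i) (toℕ j))
    where
    by-cmp : Tri (toℕ i < toℕ j) (toℕ i ≡ toℕ j) (toℕ j < toℕ i) → i ≡ j
    by-cmp (tri< i<j _ _) = contradiction eq (iterate-distinct-4 d i<j)
    by-cmp (tri≈ _ i≡j _) = toℕ-injective i≡j
    by-cmp (tri> _ _ j<i) = contradiction (sym eq) (iterate-distinct-4 d j<i)

  corner-injective : Injective _≡_ _≡_ corner
  corner-injective {f , i} {f′ , j} eq = go f≡f′ eq
    where
    f≡f′ : f ≡ f′
    f≡f′ = trans (sym (face-corner f i)) (trans (cong face eq) (face-corner f′ j))

    go : f ≡ f′ → corner (f , i) ≡ corner (f′ , j) → (f , i) ≡ (f′ , j)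
    go refl eq = cong (f ,_) (iterate-injective-4 (proj₁ (face-onto f)) eq)

  corner-↔ : (Face × Fin 4) ↔ Dart G
  corner-↔ = ⤖⇒↔ (mk⤖ (corner-injective ,
    λ d → let i , i≡ = corner-covers {d = d} refl in (face d , i) , λ { refl → i≡ }))

  -- Directions are coded in `Fin 2` so that both sides are products of finite ordinals, as
  -- `sum-reindex` and the cardinality count require.
  corner-side-↔ : (Fin #F × Fin 4) ↔ (Fin #E × Fin 2)
  corner-side-↔ = (↔-id _ ×-↔ ↔-sym 2↔Bool) ↔-∘ corner-↔

  #E≡#F*2 : #E ≡ #F ℕ.* 2
  #E≡#F*2 = ℕ.*-cancelʳ-≡ #E (#F ℕ.* 2) 2 (begin
    #E ℕ.* 2            ≡⟨ ↔⇒≡ (↔-sym *↔× ↔-∘ (corner-side-↔ ↔-∘ *↔×)) ⟨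
    #F ℕ.* 4            ≡⟨ ℕ.*-assoc #F 2 2 ⟨
    #F ℕ.* 2 ℕ.* 2      ∎)
    where open ≡-Reasoning

  #E-even : parity #E ≡ 0ℙ
  #E-even = trans (cong parity #E≡#F*2) (trans (ℙ.*-homo-* #F 2) (ℙ.*-zeroʳ (parity #F)))

  -- Rainbow faces of a proper colouring

  module _ (g : Vertex G → Fin 4) (proper : IsProper G g) where

    dartArc : Dart G → Parity
    dartArc d = arc (g (tail d)) (g (head d))

    faceColours : Face → List.List (Fin 4)
    faceColours f = List.tabulate (λ i → g (tail (corner (f , i))))

    -- The four corners run through all darts of `f`, so their tails are all its boundary vertices.
    -- This reduces being rainbow to the finite check in `arcs-parity`.
    rainbow⇔allColours : ∀ f → IsRainbow embedding g f ⇔ (∀ c → c ∈ faceColours f)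
    rainbow⇔allColours f = mk⇔ to from
      where
      to : IsRainbow embedding g f → ∀ c → c ∈ faceColours f
      to rainbow c =
        let v , (d , fd≡ , td≡) , gv≡ = rainbow c
            i , i≡ = corner-covers fd≡
        in subst (_∈ faceColours f)
             (trans (cong (g ∘ tail) i≡) (trans (cong g td≡) gv≡))
             (∈-tabulate⁺ {f = λ i → g (tail (corner (f , i)))} i)

      from : (∀ c → c ∈ faceColours f) → IsRainbow embedding g f
      from all c =
        let i , c≡ = ∈-tabulate⁻ {f = λ i → g (tail (corner (f , i)))} (all c)
        in tail (corner (f , i)) , (corner (f , i) , face-corner f i , refl) , sym c≡

    face-sum : ∀ f → (∑[ i < 4 ] dartArc (corner (f , i)))
                     ≡ indicator (does (isRainbow? embedding g f))
    face-sum f = begin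
      ∑[ i < 4 ] dartArc (corner (f , i))
        -- The head of each dart is the tail of the next, so every summand compares consecutive
        -- colours; `closing` then brings the fourth step back to the first colour.
        ≡⟨ sum-cong-≗ (λ i → cong (arc (colour i)) (cong g (sym (tail-next (corner (f , i)))))) ⟩
      ∑[ i < 4 ] arc (colour i) (g (tail (next (corner (f , i)))))
        ≡⟨ cong (λ c → arc (colour 0F) (colour 1F) ℙ.+ (arc (colour 1F) (colour 2F) ℙ.+
                       (arc (colour 2F) (colour 3F) ℙ.+ (arc (colour 3F) c ℙ.+ 0ℙ)))) closing ⟩
      arcs (colour 0F) (colour 1F) (colour 2F) (colour 3F)
        ≡⟨ arcs-parity _ _ _ _ (step 0F) (step 1F) (step 2F)
             (λ eq → step 3F (trans eq (sym closing))) ⟩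
      indicator (does (allColours? (faceColours f)))
        ≡⟨ cong indicator (does-⇔ (rainbow⇔allColours f) (isRainbow? embedding g f) (allColours? (faceColours f))) ⟨
      indicator (does (isRainbow? embedding g f)) ∎
      where
      open ≡-Reasoning
      colour : Fin 4 → Fin 4
      colour i = g (tail (corner (f , i)))

      closing : g (tail (next (corner (f , 3F)))) ≡ colour 0F
      closing = cong (g ∘ tail) (iterate-4 (corner (f , 0F)))

      step : ∀ i → colour i ≢ g (tail (next (corner (f , i))))
      step i eq = proper (corner (f , i)) (trans eq (cong g (tail-next _)))

    edge-sum : ∀ e → (∑[ s < 2 ] dartArc (e , Inverse.to 2↔Bool s)) ≡ 1ℙ
    edge-sum e = arc-tournament _ _ (proper (e , false))

    parity-#rainbow : parity (#rainbow embedding g) ≡ parity #E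
    parity-#rainbow = begin
      parity (#rainbow embedding g)
        ≡⟨ parity-count (isRainbow? embedding g) id ⟩
      ∑[ f < #F ] indicator (does (isRainbow? embedding g f))
        ≡⟨ sum-cong-≗ face-sum ⟨
      ∑[ f < #F ] ∑[ i < 4 ] dartArc (corner (f , i))
        -- The direction of each dart is sent to `Fin 2` and back, so that the summand factors
        -- through `corner-side-↔`.
        ≡⟨ sum-cong-≗ (λ f → sum-cong-≗ (λ i → cong (λ s → dartArc (edge (corner (f , i)) , s))
             (Inverse.strictlyInverseˡ 2↔Bool (proj₂ (corner (f , i)))))) ⟨
      ∑[ f < #F ] ∑[ i < 4 ] dartArc (side (Inverse.to corner-side-↔ (f , i)))
        -- The same darts are now grouped by edge instead of by face.
        ≡⟨ sum-reindex ℙ.+-0-commutativeMonoid corner-side-↔ (dartArc ∘ side) ⟨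
      ∑[ e < #E ] ∑[ s < 2 ] dartArc (side (e , s))
        ≡⟨ sum-cong-≗ edge-sum ⟩
      ∑[ e < #E ] 1ℙ
        ≡⟨ sum-1ℙ #E ⟩
      parity #E ∎
      where
      open ≡-Reasoning
      side : Fin #E × Fin 2 → Dart G
      side (e , s) = e , Inverse.to 2↔Bool s

corollary2 : ∀ (G : Graph) (k : ℕ) (Q : Quadrangulation G k) →
    ¬ (Σ (Vertex G → Fin 4) λ g →
    IsProper G g × parity (#rainbow (Quadrangulation.embedding Q) g) ≡ 1ℙ)
corollary2 G k Q (g , proper , odd) =
  contradiction (trans (sym odd) (trans (parity-#rainbow Q g proper) (#E-even Q))) λ ()
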